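{- Fix a choice of sign and let $m=(-3\pm i)^k$ with $k\in\mathbb{N}$, $k\geq1$. Then there exists a Gaussian integer $a$ with $\gcd(a,m)=1$ and $a/m\in\mathfrak{F}$ such that $K_{\mathbb{C}}(a/m)\leq 3\sqrt{2}$.
   Context: $\mathfrak{F}=\{z\in\mathbb{C}: -\tfrac12\leq\mathrm{Re}(z)<\tfrac12,\ -\tfrac12\leq\mathrm{Im}(z)<\tfrac12\}$. For $z\in\mathbb{C}$, $[z]:=\lfloor \mathrm{Re}(z)+\tfrac12\rfloor+i\lfloor \mathrm{Im}(z)+\tfrac12\rfloor$. The complex Gauss map $T:\mathfrak{F}\to\mathfrak{F}$ is $T(z)=z^{ -1}-[z^{ -1}]$ for $z\neq0$, $T(0)=0$. For $z\in\mathfrak{F}\setminus\{0\}$, $a_1(z)=[z^{ -1}]$ and, while $T^{n-1}(z)\neq0$, $a_n(z)=a_1(T^{n-1}(z))$; for $z\in\mathbb{Q}(i)\cap\mathfrak{F}$ this process terminates, giving the Hurwitz continued fraction $z=[a_1(z),\ldots,a_n(z)]_{\mathbb{C}}$. Define $K_{\mathbb{C}}(z)=\max(|a_1(z)|,\ldots,|a_n(z)|)$. -}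

module Defs where

open import Data.Nat as ℕ using (ℕ; zero; suc)
open import Data.Integer using (ℤ; +_; -_; _+_; _-_; _*_; _≤_; _<_; _◃_; +0)
open import Data.Sign using (Sign)
open import Data.Product using (Σ; _×_; _,_)
open import Data.List using (List; []; _∷_)
open import Relation.Binary.PropositionalEquality using (_≡_; _≢_)

record GI : Set where
  constructor gi
  field
    re : ℤ
    im : ℤ
open GI public

0G 1G : GI
0G = gi +0 +0
1G = gi (+ 1) +0

infixl 6 _+G_ _-G_
infixl 7 _*G_

_+G_ : GI → GI → GI
gi a b +G gi c d = gi (a + c) (b + d)

_-G_ : GI → GI → GI
gi a b -G gi c d = gi (a - c) (b - d)

_*G_ : GI → GI → GI
gi a b *G gi c d = gi (a * c - b * d) (a * d + b * c)

conj : GI → GI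
conj (gi a b) = gi a (- b)

norm : GI → ℤ
norm (gi a b) = a * a + b * b

_^G_ : GI → ℕ → GI
z ^G zero = 1G
z ^G suc n = z *G (z ^G n)

_∣G_ : GI → GI → Set
d ∣G a = Σ GI λ c → a ≡ c *G d

IsUnit : GI → Set
IsUnit u = Σ GI λ v → u *G v ≡ 1G

CoprimeG : GI → GI → Set
CoprimeG a b = (d : GI) → d ∣G a → d ∣G b → IsUnit d

base : Sign → GI
base s = gi (- (+ 3)) (s ◃ 1)

-- a / m ∈ 𝔉 (m ≠ 0): writing a/m = (a·conj m)/N(m) with N(m) > 0,
-- -1/2 ≤ Re(a/m) < 1/2  and  -1/2 ≤ Im(a/m) < 1/2.
InF : GI → GI → Set
InF a m =
  (- N ≤ + 2 * re w) × (+ 2 * re w < N) ×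
  (- N ≤ + 2 * im w) × (+ 2 * im w < N)
  where
    w = a *G conj m
    N = norm m

-- IsRoundQ x N n  (N > 0) :  n = ⌊ x/N + 1/2 ⌋,
-- i.e.  n ≤ x/N + 1/2 < n + 1,  i.e.  n·2N ≤ 2x + N < n·2N + 2N.
IsRoundQ : ℤ → ℤ → ℤ → Set
IsRoundQ x N n = (n * (+ 2 * N) ≤ + 2 * x + N) × (+ 2 * x + N < n * (+ 2 * N) + + 2 * N)

-- IsNearest q p a  (p ≠ 0) :  a = [q/p] with the paper's rounding
-- [z] = ⌊Re z + 1/2⌋ + i⌊Im z + 1/2⌋, using q/p = (q·conj p)/N(p).
IsNearest : GI → GI → GI → Set
IsNearest q p a = IsRoundQ (re w) (norm p) (re a) × IsRoundQ (im w) (norm p) (im a)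
  where w = q *G conj p

-- Expansion p q ds : the complex Gauss map algorithm applied to z = p/q
-- produces the digit list ds = [a₁(z), …, aₙ(z)] and terminates (reaches 0).
-- Step: a₁ = [1/z] = [q/p], T(z) = q/p − a₁ = (q − a₁p)/p.
data Expansion : GI → GI → List GI → Set where
  done : ∀ {q} → Expansion 0G q []
  step : ∀ {p q a ds} → p ≢ 0G → IsNearest q p a →
         Expansion (q -G a *G p) p ds → Expansion p q (a ∷ ds)

{-# OPTIONS --safe #-}
module Submission where

-- Folding.  Let [a₁, …, aₙ] have denominator q.  Then [a₁, …, aₙ, b, −aₙ, …, −a₁]
-- has denominator ± b q², and [a₁, …, aₙ₋₁, aₙ + i, −aₙ + i, −aₙ₋₁, …, −a₁] has
-- denominator ± q²; the latter is, up to a unit, the former with b = −i, after the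
-- inadmissible unit digit has been absorbed by its neighbours.  With b = −3 ± i these
-- two operations lead from k to 2k + 1 and to 2k, so every k ≥ 1 is reached from k = 1.
-- All digits stay in the strip |Re| = 3, |Im| ≤ 3, hence have norm between 9 and 18:
-- only the last digit is ever moved by i, and from length two on the last digit of a
-- folded string is −a₁, while a₁ keeps |Im| ≤ 2.
-- Digits of norm ≥ 9 force every tail into |z| < 1/2, so the folded string is the
-- one produced by the Gauss map.

open import Defs
open import Data.Nat using (ℕ; _≤_)
open import Data.Integer using (+_) renaming (_≤_ to _≤ℤ_)
open import Data.Sign using (Sign)
open import Data.Product using (Σ; _×_)
open import Data.List using (List)
open import Data.List.Relation.Unary.All using (All)

open import Algebra.Bundles using (CommutativeRing)
open import Data.Integer
  using (ℤ; +0; -[1+_]; -_; _+_; _-_; _*_; ∣_∣; +≤+; nonNegative; positive)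
  renaming (_<_ to _<ℤ_)
import Data.Integer.Properties as ℤ
open import Data.Integer.Tactic.RingSolver renaming (solve-∀ to solveℤ)
open import Data.List using ([]; _∷_; map; _ʳ++_)
open import Data.List.Relation.Unary.All as All using ([]; _∷_)
open import Data.Maybe using (just; nothing)
open import Data.Nat using (zero; suc; z≤n; s≤s)
open import Data.Nat.Binary using (ℕᵇ; zero; 2[1+_]; 1+[2_]; toℕ; fromℕ)
open import Data.Nat.Binary.Properties using (toℕ-fromℕ)
import Data.Nat as ℕ
import Data.Nat.Properties as ℕ
open import Data.Product using (_,_; proj₁; proj₂)
open import Level using (0ℓ)
open import Relation.Binary.PropositionalEquality
open import Relation.Nullary using (contradiction)
open import Tactic.RingSolver using (solve-∀)
open import Tactic.RingSolver.Core.AlmostCommutativeRing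
  using (AlmostCommutativeRing; fromCommutativeRing)

-- The Gaussian integers as a commutative ring

negG : GI → GI
negG z = gi (- re z) (- im z)

*G-comm : ∀ x y → x *G y ≡ y *G x
*G-comm (gi a b) (gi c d) = cong₂ gi (re-eq a b c d) (im-eq a b c d)
  where
  re-eq : ∀ a b c d → a * c - b * d ≡ c * a - d * b
  re-eq = solveℤ
  im-eq : ∀ a b c d → a * d + b * c ≡ c * b + d * a
  im-eq = solveℤ

*G-assoc : ∀ x y z → (x *G y) *G z ≡ x *G (y *G z)
*G-assoc (gi a b) (gi c d) (gi e f) = cong₂ gi (re-eq a b c d e f) (im-eq a b c d e f)
  where
  re-eq : ∀ a b c d e f →
    (a * c - b * d) * e - (a * d + b * c) * f ≡ a * (c * e - d * f) - b * (c * f + d * e)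
  re-eq = solveℤ
  im-eq : ∀ a b c d e f →
    (a * c - b * d) * f + (a * d + b * c) * e ≡ a * (c * f + d * e) + b * (c * e - d * f)
  im-eq = solveℤ

*G-identityˡ : ∀ x → 1G *G x ≡ x
*G-identityˡ (gi a b) = cong₂ gi (re-eq a b) (im-eq a b)
  where
  re-eq : ∀ a b → + 1 * a - +0 * b ≡ a
  re-eq = solveℤ
  im-eq : ∀ a b → + 1 * b + +0 * a ≡ b
  im-eq = solveℤ

*G-distribˡ-+G : ∀ x y z → x *G (y +G z) ≡ x *G y +G x *G z
*G-distribˡ-+G (gi a b) (gi c d) (gi e f) = cong₂ gi (re-eq a b c d e f) (im-eq a b c d e f)
  where
  re-eq : ∀ a b c d e f →
    a * (c + e) - b * (d + f) ≡ (a * c - b * d) + (a * e - b * f)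
  re-eq = solveℤ
  im-eq : ∀ a b c d e f →
    a * (d + f) + b * (c + e) ≡ (a * d + b * c) + (a * f + b * e)
  im-eq = solveℤ

+G-*G-commutativeRing : CommutativeRing 0ℓ 0ℓ
+G-*G-commutativeRing = record
  { Carrier = GI ; _≈_ = _≡_ ; _+_ = _+G_ ; _*_ = _*G_ ; -_ = negG ; 0# = 0G ; 1# = 1G
  ; isCommutativeRing = record
    { isRing = record
      { +-isAbelianGroup = record
        { isGroup = record
          { isMonoid = record
            { isSemigroup = record
              { isMagma = record { isEquivalence = isEquivalence ; ∙-cong = cong₂ _+G_ }
              ; assoc = λ x y z → cong₂ gi (ℤ.+-assoc (re x) (re y) (re z))
                                           (ℤ.+-assoc (im x) (im y) (im z)) }
            ; identity = (λ x → cong₂ gi (ℤ.+-identityˡ (re x)) (ℤ.+-identityˡ (im x)))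
                       , (λ x → cong₂ gi (ℤ.+-identityʳ (re x)) (ℤ.+-identityʳ (im x))) }
          ; inverse = (λ x → cong₂ gi (ℤ.+-inverseˡ (re x)) (ℤ.+-inverseˡ (im x)))
                    , (λ x → cong₂ gi (ℤ.+-inverseʳ (re x)) (ℤ.+-inverseʳ (im x)))
          ; ⁻¹-cong = cong negG }
        ; comm = λ x y → cong₂ gi (ℤ.+-comm (re x) (re y)) (ℤ.+-comm (im x) (im y)) }
      ; *-cong = cong₂ _*G_
      ; *-assoc = *G-assoc
      ; *-identity = comm∧idˡ⇒id *G-comm *G-identityˡ
      ; distrib = comm∧distrˡ⇒distr (cong₂ _+G_) *G-comm *G-distribˡ-+G }
    ; *-comm = *G-comm } }
  where open import Algebra.Consequences.Propositional {A = GI}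

ringG : AlmostCommutativeRing 0ℓ 0ℓ
ringG = fromCommutativeRing +G-*G-commutativeRing λ { (gi (+ 0) (+ 0)) → just refl ; _ → nothing }

-- Norm identities and inequalities

norm-*G : ∀ x y → norm (x *G y) ≡ norm x * norm y
norm-*G (gi a b) (gi c d) = identity a b c d
  where
  identity : ∀ a b c d →
    (a * c - b * d) * (a * c - b * d) + (a * d + b * c) * (a * d + b * c) ≡
    (a * a + b * b) * (c * c + d * d)
  identity = solveℤ

norm-conj : ∀ x → norm (conj x) ≡ norm x
norm-conj (gi a b) = identity a b
  where
  identity : ∀ a b → a * a + - b * - b ≡ a * a + b * b
  identity = solveℤ

-- Stands in for the triangle inequality without square roots: discarding the second term on the
-- left bounds `norm (x +G p)` from below.
parallelogram : ∀ x p → norm x + norm (x +G p +G p) ≡ + 2 * norm (x +G p) + + 2 * norm p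
parallelogram (gi a b) (gi c d) = identity a b c d
  where
  identity : ∀ a b c d →
    (a * a + b * b) + ((a + c + c) * (a + c + c) + (b + d + d) * (b + d + d)) ≡
    + 2 * ((a + c) * (a + c) + (b + d) * (b + d)) + + 2 * (c * c + d * d)
  identity = solveℤ

i*i≡+∣i∣*∣i∣ : ∀ i → i * i ≡ + (∣ i ∣ ℕ.* ∣ i ∣)
i*i≡+∣i∣*∣i∣ (+ n)        = sym (ℤ.pos-* n n)
i*i≡+∣i∣*∣i∣ -[1+ n ] = refl

0≤i*i : ∀ i → +0 ≤ℤ i * i
0≤i*i i = subst (+0 ≤ℤ_) (sym (i*i≡+∣i∣*∣i∣ i)) (+≤+ z≤n)

0≤norm : ∀ z → +0 ≤ℤ norm z
0≤norm (gi a b) = ℤ.+-mono-≤ (0≤i*i a) (0≤i*i b)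

i*i<j*j⇒i<j : ∀ {i j} → +0 ≤ℤ j → i * i <ℤ j * j → i <ℤ j
i*i<j*j⇒i<j {i} {j} 0≤j i²<j² = ℤ.≰⇒> λ j≤i → ℤ.<⇒≱ i²<j² (begin
  j * j  ≤⟨ ℤ.*-monoʳ-≤-nonNeg j ⦃ nonNegative 0≤j ⦄ j≤i ⟩
  i * j  ≤⟨ ℤ.*-monoˡ-≤-nonNeg i ⦃ nonNegative (ℤ.≤-trans 0≤j j≤i) ⦄ j≤i ⟩
  i * i  ∎)
  where open ℤ.≤-Reasoning

-- Fractions of modulus below 1/2 and rounding

-- |p/q| < 1/2
Small : GI → GI → Set
Small p q = + 4 * norm p <ℤ norm q

small⇒0<norm : ∀ p q → Small p q → +0 <ℤ norm q
small⇒0<norm p q small = ℤ.≤-<-trans (ℤ.*-monoˡ-≤-nonNeg (+ 4) (0≤norm p)) small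

-- Write N for the norm. The parallelogram law gives 9 N(q) ≤ 2 N(aq + p) + 2 N(p). Doubling this
-- and using 4 N(p) < N(q) yields 17 N(q) < 4 N(aq + p), more than the required 16 N(q).
small-step : ∀ a p q → + 9 ≤ℤ norm a → Small p q → Small q (a *G q +G p)
small-step a p q 9≤a small = ℤ.*-cancelˡ-<-nonNeg (+ 4) (begin-strict
  + 4 * (+ 4 * n)                         ≤⟨ ℤ.i≤i+j _ n ⦃ nonNegative 0≤n ⦄ ⟩
  + 4 * (+ 4 * n) + n                     ≡⟨ eighteen n ⟩
  + 2 * (+ 9 * n) - n                     ≤⟨ ℤ.+-monoˡ-≤ (- n) (ℤ.*-monoˡ-≤-nonNeg (+ 2) (begin
      + 9 * n                               ≤⟨ ℤ.*-monoʳ-≤-nonNeg n ⦃ nonNegative 0≤n ⦄ 9≤a ⟩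
      norm a * n                            ≡⟨ norm-*G a q ⟨
      norm (a *G q)                         ≤⟨ ℤ.i≤i+j _ e ⦃ nonNegative (0≤norm (a *G q +G p +G p)) ⦄ ⟩
      norm (a *G q) + e                     ≡⟨ parallelogram (a *G q) p ⟩
      + 2 * x + + 2 * norm p                ∎)) ⟩
  + 2 * (+ 2 * x + + 2 * norm p) - n      ≡⟨ four x (norm p) n ⟩
  + 4 * x - n + + 4 * norm p              <⟨ ℤ.+-monoʳ-< (+ 4 * x - n) small ⟩
  + 4 * x - n + n                         ≡⟨ cancel (+ 4 * x) n ⟩
  + 4 * x                                 ∎)
  where
  open ℤ.≤-Reasoning
  n = norm q
  x = norm (a *G q +G p)
  e = norm (a *G q +G p +G p)
  0≤n = 0≤norm q
  eighteen : ∀ n → + 4 * (+ 4 * n) + n ≡ + 2 * (+ 9 * n) - n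
  eighteen = solveℤ
  four : ∀ x y n → + 2 * (+ 2 * x + + 2 * y) - n ≡ + 4 * x - n + + 4 * y
  four = solveℤ
  cancel : ∀ x n → x - n + n ≡ x
  cancel = solveℤ

-- Strict on both sides, hence enough for both half-open conventions, that of `InF` and that of
-- `IsRoundQ`.
Within : ℤ → ℤ → Set
Within N x = (- N <ℤ x) × (x <ℤ N)

square-within : ∀ {N x} → +0 ≤ℤ N → x * x <ℤ N * N → Within N x
square-within {N} {x} 0≤N x²<N² =
    subst (- N <ℤ_) (ℤ.neg-involutive x)
      (ℤ.neg-mono-< (i*i<j*j⇒i<j 0≤N (subst (_<ℤ N * N) (sym (neg-square x)) x²<N²)))
  , i*i<j*j⇒i<j 0≤N x²<N²
  where
  neg-square : ∀ x → - x * - x ≡ x * x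
  neg-square = solveℤ

-- With w = p · conj q, multiplicativity of the norm turns the hypothesis into 4 N(w) < N(q)², and
-- the square of either doubled coordinate of w is at most 4 N(w).
small⇒within : ∀ p q → Small p q →
  Within (norm q) (+ 2 * re (p *G conj q)) × Within (norm q) (+ 2 * im (p *G conj q))
small⇒within p q small =
    square-within 0≤n (ℤ.≤-<-trans (subst (_≤ℤ + 4 * norm w) (sym (double-square (re w)))
      (ℤ.*-monoˡ-≤-nonNeg (+ 4) (ℤ.i≤i+j _ _ ⦃ nonNegative (0≤i*i (im w)) ⦄))) 4w<n²)
  , square-within 0≤n (ℤ.≤-<-trans (subst (_≤ℤ + 4 * norm w) (sym (double-square (im w)))
      (ℤ.*-monoˡ-≤-nonNeg (+ 4) (ℤ.i≤j+i _ _ ⦃ nonNegative (0≤i*i (re w)) ⦄))) 4w<n²)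
  where
  open ℤ.≤-Reasoning
  w = p *G conj q
  n = norm q
  0≤n = 0≤norm q
  double-square : ∀ x → (+ 2 * x) * (+ 2 * x) ≡ + 4 * (x * x)
  double-square = solveℤ
  4w<n² : + 4 * norm w <ℤ n * n
  4w<n² = begin-strict
    + 4 * norm w                  ≡⟨ cong (+ 4 *_) (norm-*G p (conj q)) ⟩
    + 4 * (norm p * norm (conj q)) ≡⟨ cong (λ m → + 4 * (norm p * m)) (norm-conj q) ⟩
    + 4 * (norm p * n)            ≡⟨ ℤ.*-assoc (+ 4) (norm p) n ⟨
    + 4 * norm p * n              <⟨ ℤ.*-monoʳ-<-pos n ⦃ positive (small⇒0<norm p q small) ⦄ small ⟩
    n * n                         ∎

small⇒inF : ∀ p q → Small p q → InF p q
small⇒inF p q small = ℤ.<⇒≤ (proj₁ re-within) , proj₂ re-within , ℤ.<⇒≤ (proj₁ im-within) , proj₂ im-within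
  where
  re-within = proj₁ (small⇒within p q small)
  im-within = proj₂ (small⇒within p q small)

round : ∀ N r k → Within N (+ 2 * r) → IsRoundQ (k * N + r) N k
round N r k (lo , hi) =
    (begin
      k * (+ 2 * N)                       ≡⟨ lower k N ⟩
      + 2 * (k * N) + - N + N             ≤⟨ ℤ.+-monoˡ-≤ N (ℤ.+-monoʳ-≤ (+ 2 * (k * N)) (ℤ.<⇒≤ lo)) ⟩
      + 2 * (k * N) + + 2 * r + N         ≡⟨ middle k N r ⟩
      + 2 * (k * N + r) + N               ∎)
  , (begin-strict
      + 2 * (k * N + r) + N               ≡⟨ middle k N r ⟨
      + 2 * (k * N) + + 2 * r + N         <⟨ ℤ.+-monoˡ-< N (ℤ.+-monoʳ-< (+ 2 * (k * N)) hi) ⟩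
      + 2 * (k * N) + N + N               ≡⟨ upper k N ⟩
      k * (+ 2 * N) + + 2 * N             ∎)
  where
  open ℤ.≤-Reasoning
  lower : ∀ k N → k * (+ 2 * N) ≡ + 2 * (k * N) + - N + N
  lower = solveℤ
  middle : ∀ k N r → + 2 * (k * N) + + 2 * r + N ≡ + 2 * (k * N + r) + N
  middle = solveℤ
  upper : ∀ k N → + 2 * (k * N) + N + N ≡ k * (+ 2 * N) + + 2 * N
  upper = solveℤ

-- Multiplying `a *G q +G p` by `conj q` gives a · N(q) + p · conj q, so each coordinate is a
-- multiple of N(q) plus a remainder fit for `round`.
small⇒nearest : ∀ a p q → Small p q → IsNearest (a *G q +G p) q a
small⇒nearest a p q small =
    subst (λ x → IsRoundQ x (norm q) (re a)) (sym (re-eq (re a) (im a) (re p) (im p) (re q) (im q)))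
      (round (norm q) (re (p *G conj q)) (re a) (proj₁ (small⇒within p q small)))
  , subst (λ x → IsRoundQ x (norm q) (im a)) (sym (im-eq (re a) (im a) (re p) (im p) (re q) (im q)))
      (round (norm q) (im (p *G conj q)) (im a) (proj₂ (small⇒within p q small)))
  where
  re-eq : ∀ a b c d e f →
    (a * e - b * f + c) * e - (a * f + b * e + d) * - f ≡ a * (e * e + f * f) + (c * e - d * - f)
  re-eq = solveℤ
  im-eq : ∀ a b c d e f →
    (a * e - b * f + c) * - f + (a * f + b * e + d) * e ≡ b * (e * e + f * f) + (c * - f + d * e)
  im-eq = solveℤ

-- Continued fractions and continuants

-- num u ds / den u ds = [ds], with the fraction scaled by the seed u.
num den : GI → List GI → GI
num u []       = 0G
num u (_ ∷ ds) = den u ds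
den u []       = u
den u (a ∷ ds) = a *G den u ds +G num u ds

[x+y]-x≡y : ∀ x y → (x +G y) -G x ≡ y
-- `x -G y` unfolds to `x +G negG y`, the form that the ring solver reads.
[x+y]-x≡y = cancel
  where
  cancel : ∀ x y → (x +G y) +G negG x ≡ y
  cancel = solve-∀ ringG

module _ {u : GI} (0<u : +0 <ℤ norm u) where

  num-den-small : ∀ {ds} → All (λ d → + 9 ≤ℤ norm d) ds → Small (num u ds) (den u ds)
  num-den-small []             = 0<u
  num-den-small {a ∷ ds} (9≤a ∷ 9≤ds) = small-step a (num u ds) (den u ds) 9≤a (num-den-small 9≤ds)

  -- The tail has modulus below 1/2, so the head digit is the rounding of the reciprocal, and
  -- subtracting it leaves exactly the tail.
  expansion : ∀ {ds} → All (λ d → + 9 ≤ℤ norm d) ds → Expansion (num u ds) (den u ds) ds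
  expansion []                        = done
  expansion {a ∷ ds} (9≤a ∷ 9≤ds) = step den≢0 (small⇒nearest a (num u ds) (den u ds) small)
    (subst (λ p → Expansion p (den u ds) ds) (sym ([x+y]-x≡y (a *G den u ds) (num u ds)))
      (expansion 9≤ds))
    where
    small = num-den-small 9≤ds
    den≢0 : den u ds ≢ 0G
    den≢0 eq = ℤ.<-irrefl refl (subst (λ z → +0 <ℤ norm z) eq (small⇒0<norm (num u ds) (den u ds) small))

-- Euclid's algorithm: a common divisor passes down to every tail and finally divides the seed, a
-- unit.
num-den-coprime : ∀ {u} → IsUnit u → ∀ ds → CoprimeG (num u ds) (den u ds)
num-den-coprime {u} (v , uv≡1) [] d _ (c , u≡cd) = c *G v , (begin
  d *G (c *G v)  ≡⟨ rearrange d c v ⟩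
  (c *G d) *G v  ≡⟨ cong (_*G v) u≡cd ⟨
  u *G v         ≡⟨ uv≡1 ⟩
  1G             ∎)
  where
  open ≡-Reasoning
  rearrange : ∀ d c v → d *G (c *G v) ≡ (c *G d) *G v
  rearrange = solve-∀ ringG
num-den-coprime {u} unit (a ∷ ds) d (c , q≡cd) (e , aq+p≡ed) =
  num-den-coprime unit ds d (e +G negG (a *G c) , (begin
    num u ds                                          ≡⟨ [x+y]-x≡y (a *G den u ds) (num u ds) ⟨
    (a *G den u ds +G num u ds) -G a *G den u ds      ≡⟨ cong₂ (λ x y → x -G a *G y) aq+p≡ed q≡cd ⟩
    e *G d -G a *G (c *G d)                           ≡⟨ factor a c d e ⟩
    (e +G negG (a *G c)) *G d                         ∎)) (c , q≡cd)
  where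
  open ≡-Reasoning
  factor : ∀ a c d e → e *G d +G negG (a *G (c *G d)) ≡ (e +G negG (a *G c)) *G d
  factor = solve-∀ ringG

den-scale : ∀ u ds → den u ds ≡ u *G den 1G ds
num-scale : ∀ u ds → num u ds ≡ u *G num 1G ds
num-scale u []       = zeroʳ u
  where
  zeroʳ : ∀ u → 0G ≡ u *G 0G
  zeroʳ = solve-∀ ringG
num-scale u (_ ∷ ds) = den-scale u ds
den-scale u []       = identityʳ u
  where
  identityʳ : ∀ u → u ≡ u *G 1G
  identityʳ = solve-∀ ringG
den-scale u (a ∷ ds) = trans (cong₂ (λ x y → a *G x +G y) (den-scale u ds) (num-scale u ds))
                             (factor a u (den 1G ds) (num 1G ds))
  where
  factor : ∀ a u x y → a *G (u *G x) +G u *G y ≡ u *G (a *G x +G y)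
  factor = solve-∀ ringG

-- (den 1G cs, num 1G cs) is the top row of the product of the matrices (c 1; 1 0)
-- taken over the reversal of cs.
den-ʳ++ : ∀ cs ds → den 1G (cs ʳ++ ds) ≡ den 1G cs *G den 1G ds +G num 1G cs *G num 1G ds
den-ʳ++ []       ds = identity (den 1G ds) (num 1G ds)
  where
  identity : ∀ x y → x ≡ 1G *G x +G 0G *G y
  identity = solve-∀ ringG
den-ʳ++ (c ∷ cs) ds = trans (den-ʳ++ cs (c ∷ ds))
                            (regroup c (den 1G cs) (num 1G cs) (den 1G ds) (num 1G ds))
  where
  regroup : ∀ c x y z w → x *G (c *G z +G w) +G y *G z ≡ (c *G x +G y) *G z +G x *G w
  regroup = solve-∀ ringG

-- Negated digits and the two foldings

length-sign : List GI → GI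
length-sign []       = 1G
length-sign (_ ∷ ds) = negG (length-sign ds)

negG-square : ∀ x → negG x *G negG x ≡ x *G x
negG-square = solve-∀ ringG

length-sign-square : ∀ ds → length-sign ds *G length-sign ds ≡ 1G
length-sign-square []       = refl
length-sign-square (_ ∷ ds) = trans (negG-square (length-sign ds)) (length-sign-square ds)

-- A continuant of n digits is a sum of products of n, n - 2, ... digits, so it has the parity of n.
-- The numerator involves one digit fewer, whence its opposite sign.
den-map-negG : ∀ ds → den 1G (map negG ds) ≡ length-sign ds *G den 1G ds
num-map-negG : ∀ ds → num 1G (map negG ds) ≡ negG (length-sign ds *G num 1G ds)
num-map-negG []       = refl
num-map-negG (_ ∷ ds) = trans (den-map-negG ds) (double-negation (length-sign ds) (den 1G ds))
  where
  double-negation : ∀ x y → x *G y ≡ negG (negG x *G y)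
  double-negation = solve-∀ ringG
den-map-negG []       = refl
den-map-negG (a ∷ ds) = trans (cong₂ (λ x y → negG a *G x +G y) (den-map-negG ds) (num-map-negG ds))
                              (factor a (length-sign ds) (den 1G ds) (num 1G ds))
  where
  factor : ∀ a e x y → negG a *G (e *G x) +G negG (e *G y) ≡ negG e *G (a *G x +G y)
  factor = solve-∀ ringG

-- Foldings of the expansion whose digits, read from the last to the first, are
-- the given list.  Reversal does not change the denominator.
fold-even : List GI → List GI
fold-even []       = []
fold-even (a ∷ cs) = cs ʳ++ (a +G gi +0 (+ 1) ∷ negG a +G gi +0 (+ 1) ∷ map negG cs)

fold-odd : GI → List GI → List GI
fold-odd b ds = ds ʳ++ (b ∷ map negG ds)

-- For an arbitrary shift `v` the denominator differs from the claimed value by a multiple of v² +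
-- 1, which vanishes at v = i.
den-fold-even : ∀ a cs → let q = den 1G (a ∷ cs) in
  den 1G (fold-even (a ∷ cs)) ≡ length-sign (a ∷ cs) *G (q *G q)
den-fold-even a cs = begin
  den 1G (fold-even (a ∷ cs))
    ≡⟨ den-ʳ++ cs _ ⟩
  r *G ((a +G v) *G ((negG a +G v) *G r⁻ +G s⁻) +G r⁻) +G s *G ((negG a +G v) *G r⁻ +G s⁻)
    ≡⟨ cong₂ (λ x y → r *G ((a +G v) *G ((negG a +G v) *G x +G y) +G x) +G s *G ((negG a +G v) *G x +G y))
             (den-map-negG cs) (num-map-negG cs) ⟩
  r *G ((a +G v) *G ((negG a +G v) *G (e *G r) +G negG (e *G s)) +G e *G r)
    +G s *G ((negG a +G v) *G (e *G r) +G negG (e *G s))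
    ≡⟨ expand a v r s e ⟩
  negG e *G (q *G q) +G (v *G v +G 1G) *G (e *G (r *G r))
    -- Here `v *G v +G 1G` computes to `0G`.
    ≡⟨ drop-zero (negG e *G (q *G q)) (e *G (r *G r)) ⟩
  negG e *G (q *G q)
    ∎
  where
  open ≡-Reasoning
  v = gi +0 (+ 1)
  r = den 1G cs
  s = num 1G cs
  r⁻ = den 1G (map negG cs)
  s⁻ = num 1G (map negG cs)
  e = length-sign cs
  q = a *G r +G s
  expand : ∀ a v r s e →
    r *G ((a +G v) *G ((negG a +G v) *G (e *G r) +G negG (e *G s)) +G e *G r)
      +G s *G ((negG a +G v) *G (e *G r) +G negG (e *G s))
    ≡ negG e *G ((a *G r +G s) *G (a *G r +G s)) +G (v *G v +G 1G) *G (e *G (r *G r))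
  expand = solve-∀ ringG
  drop-zero : ∀ x y → x +G 0G *G y ≡ x
  drop-zero = solve-∀ ringG

-- The two mixed terms in `p *G q` cancel, since negating the digits gives numerator and denominator
-- opposite signs.
den-fold-odd : ∀ b ds → let q = den 1G ds in
  den 1G (fold-odd b ds) ≡ length-sign ds *G (b *G (q *G q))
den-fold-odd b ds = begin
  den 1G (fold-odd b ds)
    ≡⟨ den-ʳ++ ds _ ⟩
  q *G (b *G den 1G (map negG ds) +G num 1G (map negG ds)) +G p *G den 1G (map negG ds)
    ≡⟨ cong₂ (λ x y → q *G (b *G x +G y) +G p *G x) (den-map-negG ds) (num-map-negG ds) ⟩
  q *G (b *G (e *G q) +G negG (e *G p)) +G p *G (e *G q)
    ≡⟨ expand b p q e ⟩
  e *G (b *G (q *G q))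
    ∎
  where
  open ≡-Reasoning
  p = num 1G ds
  q = den 1G ds
  e = length-sign ds
  expand : ∀ b p q e →
    q *G (b *G (e *G q) +G negG (e *G p)) +G p *G (e *G q) ≡ e *G (b *G (q *G q))
  expand = solve-∀ ringG

-- The strip that contains the digits

-- Norms lie between 9 and 9 + n²; for n = 3 the upper end is 18, the square of 3√2.
record Strip (n : ℕ) (z : GI) : Set where
  constructor strip
  field
    ∣re∣≡3 : ∣ re z ∣ ≡ 3
    ∣im∣≤n : ∣ im z ∣ ≤ n

strip-weaken : ∀ {m n z} → m ≤ n → Strip m z → Strip n z
strip-weaken m≤n (strip re≡3 im≤m) = strip re≡3 (ℕ.≤-trans im≤m m≤n)

strip-negG : ∀ {n z} → Strip n z → Strip n (negG z)
strip-negG {n} {z} (strip re≡3 im≤n) = strip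
  (trans (ℤ.∣-i∣≡∣i∣ (re z)) re≡3)
  (subst (_≤ n) (sym (ℤ.∣-i∣≡∣i∣ (im z))) im≤n)

strip-+i : ∀ {n z} → Strip n z → Strip (suc n) (z +G gi +0 (+ 1))
strip-+i {n} {z} (strip re≡3 im≤n) = strip
  (trans (cong ∣_∣ (ℤ.+-identityʳ (re z))) re≡3)
  (ℕ.≤-trans (ℤ.∣i+j∣≤∣i∣+∣j∣ (im z) (+ 1))
    (subst (∣ im z ∣ ℕ.+ 1 ≤_) (ℕ.+-comm n 1) (ℕ.+-monoˡ-≤ 1 im≤n)))

strip⇒norm≡ : ∀ {n z} → Strip n z → norm z ≡ + (9 ℕ.+ ∣ im z ∣ ℕ.* ∣ im z ∣)
strip⇒norm≡ {n} {z} (strip re≡3 _) =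
  cong₂ _+_ (trans (i*i≡+∣i∣*∣i∣ (re z)) (cong (λ m → + (m ℕ.* m)) re≡3)) (i*i≡+∣i∣*∣i∣ (im z))

strip⇒9≤norm : ∀ {n z} → Strip n z → + 9 ≤ℤ norm z
strip⇒9≤norm s = subst (+ 9 ≤ℤ_) (sym (strip⇒norm≡ s)) (+≤+ (ℕ.m≤m+n 9 _))

strip⇒norm≤ : ∀ {n z} → Strip n z → norm z ≤ℤ + (9 ℕ.+ n ℕ.* n)
strip⇒norm≤ {n} s@(strip _ im≤n) = subst (_≤ℤ + (9 ℕ.+ n ℕ.* n)) (sym (strip⇒norm≡ s))
  (+≤+ (ℕ.+-monoʳ-≤ 9 (ℕ.*-mono-≤ im≤n im≤n)))

-- Reversal brings the final digit to the head, where the next `fold-even` may move it by i;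
-- `Strip 2` leaves room for that.
data Chain : List GI → Set where
  [_] : ∀ {a} → Strip 2 a → Chain (a ∷ [])
  _∷_ : ∀ {a ds} → Strip 3 a → Chain ds → Chain (a ∷ ds)

-- In a string of length one the same digit is moved by i and then kept as an outer
-- digit, whence the smaller bound.
data Foldable : List GI → Set where
  single : ∀ {a} → Strip 1 a → Foldable (a ∷ [])
  many   : ∀ {a ds} → Strip 2 a → Chain ds → Foldable (a ∷ ds)

chain-map-negG : ∀ {ds} → Chain ds → Chain (map negG ds)
chain-map-negG [ a ]    = [ strip-negG a ]
chain-map-negG (a ∷ ds) = strip-negG a ∷ chain-map-negG ds

chain⇒strip : ∀ {ds} → Chain ds → All (Strip 3) ds
chain⇒strip [ a ]    = strip-weaken (ℕ.n≤1+n 2) a ∷ []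
chain⇒strip (a ∷ ds) = a ∷ chain⇒strip ds

foldable⇒chain : ∀ {ds} → Foldable ds → Chain ds
foldable⇒chain (single a)  = [ strip-weaken (ℕ.n≤1+n 1) a ]
foldable⇒chain (many a ds) = strip-weaken (ℕ.n≤1+n 2) a ∷ ds

foldable-ʳ++ : ∀ {cs ds} → Chain cs → Chain ds → Foldable (cs ʳ++ ds)
foldable-ʳ++ [ a ]    ds = many a ds
foldable-ʳ++ (a ∷ cs) ds = foldable-ʳ++ cs (a ∷ ds)

-- From length two on, the moved digits land in the interior, where `Strip 3` is allowed.
foldable-fold-even : ∀ {ds} → Foldable ds → Foldable (fold-even ds)
foldable-fold-even (single a)  = many (strip-+i a) [ strip-+i (strip-negG a) ]
foldable-fold-even (many a cs) =
  foldable-ʳ++ cs (strip-+i a ∷ strip-+i (strip-negG a) ∷ chain-map-negG cs)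

foldable-fold-odd : ∀ {b ds} → Strip 3 b → Foldable ds → Foldable (fold-odd b ds)
foldable-fold-odd b ds = foldable-ʳ++ (foldable⇒chain ds) (b ∷ chain-map-negG (foldable⇒chain ds))

-- Powers of the base as denominators

^G-distribˡ-+-*G : ∀ z m n → z ^G (m ℕ.+ n) ≡ z ^G m *G z ^G n
^G-distribˡ-+-*G z zero    n = sym (*G-identityˡ (z ^G n))
^G-distribˡ-+-*G z (suc m) n =
  trans (cong (z *G_) (^G-distribˡ-+-*G z m n)) (sym (*G-assoc z (z ^G m) (z ^G n)))

^G-double : ∀ z n → z ^G (2 ℕ.* n) ≡ z ^G n *G z ^G n
^G-double z n = trans (cong (λ m → z ^G (n ℕ.+ m)) (ℕ.+-identityʳ n)) (^G-distribˡ-+-*G z n n)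

-- With `unit` equal to ±1 instead of an arbitrary unit, m² is exactly the square of the
-- denominator, so the only unit to record after a fold is the sign of that fold.
record Represents (m : GI) : Set where
  field
    digits      : List GI
    foldable    : Foldable digits
    unit        : GI
    unit-square : unit *G unit ≡ 1G
    value       : unit *G den 1G digits ≡ m

represents-square : ∀ {m} → Represents m → Represents (m *G m)
represents-square {m} record { digits = a ∷ cs ; foldable = foldable
  ; unit = u ; unit-square = u²≡1 ; value = uq≡m } =
  record
    { digits      = fold-even (a ∷ cs)
    ; foldable    = foldable-fold-even foldable
    ; unit        = e
    ; unit-square = e²≡1
    ; value       = begin
        e *G den 1G (fold-even (a ∷ cs))  ≡⟨ cong (e *G_) (den-fold-even a cs) ⟩
        e *G (e *G (q *G q))              ≡⟨ *G-assoc e e (q *G q) ⟨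
        (e *G e) *G (q *G q)              ≡⟨ cong (_*G (q *G q)) (trans e²≡1 (sym u²≡1)) ⟩
        (u *G u) *G (q *G q)              ≡⟨ regroup u q ⟩
        (u *G q) *G (u *G q)              ≡⟨ cong₂ _*G_ uq≡m uq≡m ⟩
        m *G m                            ∎
    }
  where
  open ≡-Reasoning
  q = den 1G (a ∷ cs)
  e = length-sign (a ∷ cs)
  e²≡1 = length-sign-square (a ∷ cs)
  regroup : ∀ u q → (u *G u) *G (q *G q) ≡ (u *G q) *G (u *G q)
  regroup = solve-∀ ringG

represents-*-square : ∀ {b m} → Strip 3 b → Represents m → Represents (b *G (m *G m))
represents-*-square {b} {m} b-strip record { digits = ds ; foldable = foldable
  ; unit = u ; unit-square = u²≡1 ; value = uq≡m } =
  record
    { digits      = fold-odd b ds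
    ; foldable    = foldable-fold-odd b-strip foldable
    ; unit        = e
    ; unit-square = e²≡1
    ; value       = begin
        e *G den 1G (fold-odd b ds)       ≡⟨ cong (e *G_) (den-fold-odd b ds) ⟩
        e *G (e *G (b *G (q *G q)))       ≡⟨ *G-assoc e e (b *G (q *G q)) ⟨
        (e *G e) *G (b *G (q *G q))       ≡⟨ cong (_*G (b *G (q *G q))) (trans e²≡1 (sym u²≡1)) ⟩
        (u *G u) *G (b *G (q *G q))       ≡⟨ regroup b u q ⟩
        b *G ((u *G q) *G (u *G q))       ≡⟨ cong (b *G_) (cong₂ _*G_ uq≡m uq≡m) ⟩
        b *G (m *G m)                     ∎
    }
  where
  open ≡-Reasoning
  q = den 1G ds
  e = length-sign ds
  e²≡1 = length-sign-square ds
  regroup : ∀ b u q → (u *G u) *G (b *G (q *G q)) ≡ b *G ((u *G q) *G (u *G q))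
  regroup = solve-∀ ringG

strip-base : ∀ s → Strip 1 (base s)
strip-base Sign.+ = strip refl ℕ.≤-refl
strip-base Sign.- = strip refl ℕ.≤-refl

-- The exponent is shifted by one, so that the two constructors of ℕᵇ become
-- k ↦ 2 k and k ↦ 1 + 2 k.
represents-base^ : ∀ s (n : ℕᵇ) → Represents (base s ^G suc (toℕ n))
represents-base^ s zero = record
  { digits = base s ∷ [] ; foldable = single (strip-base s)
  ; unit = 1G ; unit-square = refl ; value = simplify (base s) }
  where
  simplify : ∀ b → 1G *G (b *G 1G +G 0G) ≡ b *G 1G
  simplify = solve-∀ ringG
represents-base^ s 1+[2 n ] =
  subst Represents (trans (sym (^G-double (base s) (suc (toℕ n)))) (cong (base s ^G_) (ℕ.*-suc 2 (toℕ n))))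
    (represents-square (represents-base^ s n))
represents-base^ s 2[1+ n ] =
  subst Represents (cong (base s *G_) (sym (^G-double (base s) (suc (toℕ n)))))
    (represents-*-square {base s} (strip-weaken (s≤s z≤n) (strip-base s)) (represents-base^ s n))

-- From denominators to bounded expansions

0<norm-unit : ∀ u → u *G u ≡ 1G → +0 <ℤ norm u
0<norm-unit u u²≡1 = ℤ.≤∧≢⇒< (0≤norm u) λ 0≡norm →
  contradiction (trans (cong (λ n → n * n) 0≡norm) (trans (sym (norm-*G u u)) (cong norm u²≡1))) λ ()

BoundedExpansion : GI → Set
BoundedExpansion m = Σ GI λ a → CoprimeG a m × InF a m ×
  Σ (List GI) λ ds → Expansion a m ds × All (λ d → norm d ≤ℤ + 18) ds

represents⇒boundedExpansion : ∀ {m} → Represents m → BoundedExpansion m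
represents⇒boundedExpansion record { digits = ds ; foldable = foldable
  ; unit = u ; unit-square = u²≡1 ; value = uq≡m } =
  -- Taking the recorded unit as seed makes the denominator `m` itself, not just an associate of it.
  subst BoundedExpansion (trans (den-scale u ds) uq≡m)
    ( num u ds
    , num-den-coprime (u , u²≡1) ds
    , small⇒inF (num u ds) (den u ds) (num-den-small {u} 0<u 9≤norm)
    , ds
    , expansion {u} 0<u 9≤norm
    , All.map strip⇒norm≤ strips )
  where
  0<u = 0<norm-unit u u²≡1
  strips = chain⇒strip (foldable⇒chain foldable)
  9≤norm = All.map strip⇒9≤norm strips

theorem5p1 : (s : Sign) (k : ℕ) → 1 ≤ k →
    Σ GI λ a → CoprimeG a (base s ^G k) × InF a (base s ^G k) ×
    Σ (List GI) λ ds → Expansion a (base s ^G k) ds × All (λ d → norm d ≤ℤ + 18) ds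
theorem5p1 s (suc n) _ = represents⇒boundedExpansion
  -- The recursion follows the binary digits of `n`, which is k - 1.
  (subst (λ k → Represents (base s ^G suc k)) (toℕ-fromℕ n) (represents-base^ s (fromℕ n)))
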